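{- Let $L$ be a bounded distributive lattice, let $B$ be a finite discrete Boolean algebra, and let $\vdash$ be the entailment relation of lattice maps $L\to B$ on $L\times B$ (generated by the axioms listed in the context). For every finite subset $X$ of $L\times B$ and every finite set of pairs $(y_1,b_1),\dots,(y_k,b_k)\in L\times B$, the following are equivalent: (1) $X\vdash(y_1,b_1),\dots,(y_k,b_k)$; (2) for all $b_1',\dots,b_k'\in B$ with $b_1'\neq b_1,\dots,b_k'\neq b_k$ there is $e\in\mathrm{At}\,B$ such that $$\bigwedge_{a\geq e}\bigwedge\big(X\cup\{(y_i,b_i')\}_{1\leq i\leq k}\big)_a\ \leq\ \bigvee_{a\geq e}\bigvee\big(X\cup\{(y_i,b_i')\}_{1\leq i\leq k}\big)_{ -a}\quad\text{in } L.$$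
   Context: Reasoning is constructive (formalizable in constructive Zermelo–Fraenkel set theory CZF). A set $S$ is finite if there are $n\in\mathbb N$ and a surjection $\{1,\dots,n\}\to S$; it is discrete if its equality is decidable. Lattices are distributive and bounded, with top $1$ (the empty meet) and bottom $0$ (the empty join); lattice maps preserve $\wedge,\vee,0,1$. $-a$ is the complement of $a$ in a Boolean algebra. $\mathrm{At}\,B$ is the set of atoms of $B$, i.e. minimal non-zero elements. An entailment relation on a set $S$ is a relation $\vdash$ between finite subsets of $S$ satisfying (R): $X\vdash Y$ whenever $X$ and $Y$ have a common element; (M): $X\vdash Y$ implies $X\cup X'\vdash Y\cup Y'$; (T): $X\vdash Y\cup\{x\}$ and $X\cup\{x\}\vdash Y$ imply $X\vdash Y$. Commas denote union, singleton braces are dropped, and an empty side is left blank. The entailment relation generated by a set of axioms (pairs of finite subsets) is the least one containing them. The entailment relation of lattice maps $L\to B$ is the entailment relation on $L\times B$ generated by all instances of: (s) $(x,a),(x,b)\vdash$ for $a\neq b$; ($\wedge$) $(x,a),(y,b)\vdash(x\wedge y,a\wedge b)$; ($\vee$) $(x,a),(y,b)\vdash(x\vee y,a\vee b)$; (0) $\vdash(0_L,0_B)$; (1) $\vdash(1_L,1_B)$; (t) $\vdash\{(x,a):a\in B\}$. For a finite $X\subseteq L\times B$ and $a\in B$, $X_a=\{x\in L:(x,a)\in X\}$. In $\bigwedge_{a\geq e}$ and $\bigvee_{a\geq e}$, $a$ ranges over all elements of $B$ with $a\geq e$. -}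

module Defs where

open import Data.Fin.Base using (Fin)
open import Data.List.Base using (List; []; _∷_; [_]; map; filter; foldr; tabulate)
open import Data.Nat.Base using (ℕ)
open import Data.Product.Base using (_×_; _,_; proj₁; proj₂)
open import Data.Product.Relation.Binary.Pointwise.NonDependent using (×-setoid)
open import Function.Bundles using (Surjection)
open import Level using (Level; _⊔_; suc)
open import Relation.Binary.Bundles using (Setoid)
open import Relation.Binary.Core using (Rel)
open import Relation.Binary.Definitions using (Decidable; Maximum; Minimum)
open import Relation.Binary.Lattice.Bundles using (DistributiveLattice; BooleanAlgebra)
import Relation.Binary.Lattice.Properties.MeetSemilattice as MeetSemilatticeProperties
import Relation.Binary.PropositionalEquality as ≡
open import Relation.Nullary.Negation using (¬_)

import Data.List.Membership.Setoid as Membership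
import Data.List.Relation.Binary.Subset.Setoid as Subset

private
  variable
    c ℓ₁ ℓ₂ c′ ℓ₁′ ℓ₂′ r : Level

record BoundedDistributiveLattice c ℓ₁ ℓ₂ : Set (suc (c ⊔ ℓ₁ ⊔ ℓ₂)) where
  field
    distributiveLattice : DistributiveLattice c ℓ₁ ℓ₂

  open DistributiveLattice distributiveLattice public

  field
    ⊤       : Carrier
    ⊥       : Carrier
    maximum : Maximum _≤_ ⊤
    minimum : Minimum _≤_ ⊥

  ⋀ ⋁ : List Carrier → Carrier
  ⋀ = foldr _∧_ ⊤
  ⋁ = foldr _∨_ ⊥

record FiniteDiscreteBooleanAlgebra c ℓ₁ ℓ₂ : Set (suc (c ⊔ ℓ₁ ⊔ ℓ₂)) where
  infix 4 _≟_
  field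
    booleanAlgebra : BooleanAlgebra c ℓ₁ ℓ₂

  open BooleanAlgebra booleanAlgebra public renaming (¬_ to -_)

  field
    _≟_         : Decidable _≈_
    size        : ℕ
    enumeration : Surjection (≡.setoid (Fin size)) setoid

  -- Possibly with repetitions.
  elements : List Carrier
  elements = tabulate (Surjection.to enumeration)

  _≤?_ : Decidable _≤_
  _≤?_ = MeetSemilatticeProperties.≈-dec⇒≤-dec meetSemilattice _≟_

  _≉_ : Rel Carrier ℓ₁
  a ≉ b = ¬ (a ≈ b)

  record IsAtom (e : Carrier) : Set (c ⊔ ℓ₁ ⊔ ℓ₂) where
    field
      nonzero : e ≉ ⊥
      minimal : ∀ {a} → a ≉ ⊥ → a ≤ e → a ≈ e

-- Finite subsets of S are represented by lists, which are compared only
-- through membership up to the equality of S.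
module Entailment {c ℓ} (S : Setoid c ℓ) where

  open Setoid S using (Carrier)
  open Membership S using (_∈_)
  open Subset S using (_⊆_)

  FinRel : ∀ r → Set (c ⊔ suc r)
  FinRel r = Rel (List Carrier) r

  -- Since X ⊆ X′ holds exactly when X′ and X ∪ X′ are the same finite subset,
  -- `mono` expresses (M) together with invariance under the choice of lists.
  record IsEntailmentRelation (_⊢_ : FinRel r) : Set (c ⊔ ℓ ⊔ r) where
    field
      reflexive  : ∀ {X Y x} → x ∈ X → x ∈ Y → X ⊢ Y
      mono       : ∀ {X X′ Y Y′} → X ⊆ X′ → Y ⊆ Y′ → X ⊢ Y → X′ ⊢ Y′
      transitive : ∀ {X Y x} → X ⊢ (x ∷ Y) → (x ∷ X) ⊢ Y → X ⊢ Y

  data Generated (Ax : FinRel r) : FinRel (c ⊔ ℓ ⊔ r) where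
    axiom : ∀ {X Y} → Ax X Y → Generated Ax X Y
    refl  : ∀ {X Y x} → x ∈ X → x ∈ Y → Generated Ax X Y
    mono  : ∀ {X X′ Y Y′} → X ⊆ X′ → Y ⊆ Y′ → Generated Ax X Y → Generated Ax X′ Y′
    trans : ∀ {X Y x} → Generated Ax X (x ∷ Y) → Generated Ax (x ∷ X) Y → Generated Ax X Y

  generated-isEntailmentRelation : (Ax : FinRel r) → IsEntailmentRelation (Generated Ax)
  generated-isEntailmentRelation Ax = record
    { reflexive  = refl
    ; mono       = mono
    ; transitive = trans
    }

  generated-least : ∀ {r r′} {Ax : FinRel r} {_⊢_ : FinRel r′} → IsEntailmentRelation _⊢_ →
                    (∀ {X Y} → Ax X Y → X ⊢ Y) → ∀ {X Y} → Generated Ax X Y → X ⊢ Y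
  generated-least E h (axiom p)    = h p
  generated-least E h (refl p q)   = IsEntailmentRelation.reflexive E p q
  generated-least E h (mono p q d) = IsEntailmentRelation.mono E p q (generated-least E h d)
  generated-least E h (trans d d′) =
    IsEntailmentRelation.transitive E (generated-least E h d) (generated-least E h d′)

module LatticeMaps (L : BoundedDistributiveLattice c ℓ₁ ℓ₂)
                   (B : FiniteDiscreteBooleanAlgebra c′ ℓ₁′ ℓ₂′) where

  private
    module L = BoundedDistributiveLattice L
    module B = FiniteDiscreteBooleanAlgebra B

  L×B : Setoid (c ⊔ c′) (ℓ₁ ⊔ ℓ₁′)
  L×B = ×-setoid L.setoid B.setoid

  open Entailment L×B

  data Axiom : FinRel (c ⊔ c′ ⊔ ℓ₁′) where
    ax-s : ∀ {x a b} → a B.≉ b → Axiom ((x , a) ∷ (x , b) ∷ []) []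
    ax-∧ : ∀ {x y a b} → Axiom ((x , a) ∷ (y , b) ∷ []) [ (x L.∧ y , a B.∧ b) ]
    ax-∨ : ∀ {x y a b} → Axiom ((x , a) ∷ (y , b) ∷ []) [ (x L.∨ y , a B.∨ b) ]
    ax-0 : Axiom [] [ (L.⊥ , B.⊥) ]
    ax-1 : Axiom [] [ (L.⊤ , B.⊤) ]
    ax-t : ∀ {x} → Axiom [] (map (x ,_) B.elements)

  infix 4 _⊢_
  _⊢_ : FinRel (c ⊔ ℓ₁ ⊔ c′ ⊔ ℓ₁′)
  _⊢_ = Generated Axiom

  -- The subset X_a = { x | (x , a) ∈ X }.
  fibre : List (L.Carrier × B.Carrier) → B.Carrier → List L.Carrier
  fibre X a = map proj₁ (filter (λ p → proj₂ p B.≟ a) X)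

  ⋀[a≥_] ⋁[a≥_] : B.Carrier → (B.Carrier → L.Carrier) → L.Carrier
  ⋀[a≥ e ] f = L.⋀ (map f (filter (e B.≤?_) B.elements))
  ⋁[a≥ e ] f = L.⋁ (map f (filter (e B.≤?_) B.elements))

{-# OPTIONS --safe #-}

-- Say that Z is inconsistent at an atom e when ⋀ P ≤ ⋁ Q, where P collects the
-- x with (x , a) ∈ Z and e ≤ a, and Q those with e ≰ a.  Then X ⊢ Y holds
-- exactly when every Z ⊇ X that pairs the first component of each element of Y
-- with a wrong value is inconsistent at some atom.
--
-- Soundness: the right-hand side is itself an entailment relation satisfying
-- the axioms.  Only its cut rule is not immediate.  Let Z ∪ {(u , a)} be
-- inconsistent at some atom for every a, and let c be such that at every atom
-- e ≤ c some (u , a) with e ≰ a is inconsistent with Z.  Query a = c: if the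
-- atom obtained is below c, then cut in L makes Z itself inconsistent there;
-- otherwise join this atom to c and repeat.
--
-- Completeness: if Z is inconsistent at e, then Z derives (⋀ P , p) with e ≤ p
-- and (⋁ Q , q) with e ≰ q, hence (⋀ P , p ∧ q), which clashes with (⋀ P , p).
-- The general case reduces to Y = ∅ by cutting with the totality axioms.

module Submission where

open import Defs
open import Data.Empty using (⊥-elim)
open import Data.Fin.Base using (Fin; zero; suc)
open import Data.List.Base using (List; []; _∷_; [_]; _++_; tabulate; map; filter; length)
open import Data.List.Properties using (filter-notAll)
open import Data.List.Relation.Unary.All as All using (All; []; _∷_)
import Data.List.Relation.Unary.All.Properties as All
open import Data.List.Relation.Unary.Any as Any using (Any; here; there)
import Data.List.Relation.Unary.Any.Properties as Any
open import Data.List.Membership.Propositional using (find; lose) renaming (_∈_ to _∈ₚ_)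
open import Data.List.Membership.Propositional.Properties
  using () renaming (∈-map⁺ to ∈ₚ-map⁺; ∈-filter⁺ to ∈ₚ-filter⁺; ∈-filter⁻ to ∈ₚ-filter⁻)
import Data.List.Membership.Setoid as Membership
import Data.List.Membership.Setoid.Properties as ∈
import Data.List.Relation.Binary.Permutation.Setoid.Properties as Permutation
import Data.List.Relation.Binary.Subset.Setoid as Subset
import Data.List.Relation.Binary.Subset.Setoid.Properties as ⊆
open import Data.Nat.Base using (ℕ; zero; suc; _<_)
open import Data.Nat.Induction using (<-wellFounded)
open import Data.Product.Base using (_×_; _,_; ∃-syntax; proj₁; proj₂)
open import Data.Sum.Base as Sum using (_⊎_; inj₁; inj₂)
import Data.Vec.Functional as Vector
open import Function.Base using (_∘_; id)
open import Function.Bundles using (_⇔_; mk⇔; Surjection)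
open import Induction.WellFounded using (Acc; acc)
import Relation.Binary.Lattice.Properties.HeytingAlgebra as HeytingAlgebra
import Relation.Binary.Lattice.Properties.JoinSemilattice as JoinSemilattice
import Relation.Binary.Lattice.Properties.MeetSemilattice as MeetSemilattice
open import Relation.Nullary.Decidable.Core using (Dec; yes; no; ¬?)
open import Relation.Nullary.Negation.Core using (¬_)
import Relation.Binary.PropositionalEquality.Core as ≡

-- Bounds of finite meets and joins, and cut, in a distributive lattice.

module BoundedDistributiveLatticeProperties
  {c ℓ₁ ℓ₂} (L : BoundedDistributiveLattice c ℓ₁ ℓ₂) where

  open BoundedDistributiveLattice L
  open JoinSemilattice joinSemilattice using (∨-monotonic)

  ⋀-lower : ∀ {x xs} → Any (_≤ x) xs → ⋀ xs ≤ x
  ⋀-lower (here y≤x)  = trans (x∧y≤x _ _) y≤x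
  ⋀-lower (there any) = trans (x∧y≤y _ _) (⋀-lower any)

  ⋁-upper : ∀ {x xs} → Any (x ≤_) xs → x ≤ ⋁ xs
  ⋁-upper (here x≤y)  = trans x≤y (x≤x∨y _ _)
  ⋁-upper (there any) = trans (⋁-upper any) (y≤x∨y _ _)

  -- By distributivity `p` lies below `(p ∧ q) ∨ (p ∧ u)`, and both joinands lie below `q`.
  ≤-cut : ∀ {p q u} → p ≤ q ∨ u → p ∧ u ≤ q → p ≤ q
  ≤-cut p≤q∨u p∧u≤q =
    trans (∧-greatest refl p≤q∨u)
      (trans (reflexive (∧-distribˡ-∨ _ _ _)) (∨-least (x∧y≤y _ _) p∧u≤q))

-- Complements and atoms in a finite discrete Boolean algebra.

module FiniteDiscreteBooleanAlgebraProperties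
  {c ℓ₁ ℓ₂} (B : FiniteDiscreteBooleanAlgebra c ℓ₁ ℓ₂) where

  open FiniteDiscreteBooleanAlgebra B
  open HeytingAlgebra heytingAlgebra using (∧-distribˡ-∨-≤)
  open JoinSemilattice joinSemilattice using (∨-comm; ∨-monotonic)
  open MeetSemilattice meetSemilattice using (∧-comm; ∧-monotonic)
  open Membership setoid using (_∈_)

  infix 4 _≰_
  _≰_ : Carrier → Carrier → Set _
  a ≰ b = ¬ (a ≤ b)

  ∈-elements : ∀ a → a ∈ elements
  ∈-elements a =
    let i , to≈a = Surjection.surjective enumeration a
    in Any.tabulate⁺ i (Eq.sym (to≈a ≡.refl))

  ∧-disjoint⇒≤ : ∀ {a b d} → a ∧ b ≤ ⊥ → a ≤ b ∨ d → a ≤ d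
  ∧-disjoint⇒≤ a∧b≤⊥ a≤b∨d =
    trans (∧-greatest refl a≤b∨d)
      (trans (∧-distribˡ-∨-≤ _ _ _)
        (∨-least (trans a∧b≤⊥ (minimum _)) (x∧y≤y _ _)))

  -a∧a≤⊥ : ∀ {a} → - a ∧ a ≤ ⊥
  -a∧a≤⊥ = transpose-∧ (x≤x∨y _ _)

  ⊤≤-a∨a : ∀ {a} → ⊤ ≤ - a ∨ a
  ⊤≤-a∨a = transpose-⇨ (x∧y≤y _ _)

  ⊤≤a∨-a : ∀ {a} → ⊤ ≤ a ∨ - a
  ⊤≤a∨-a = trans ⊤≤-a∨a (reflexive (∨-comm _ _))

  a∧-a≤⊥ : ∀ {a} → a ∧ - a ≤ ⊥
  a∧-a≤⊥ = trans (reflexive (∧-comm _ _)) -a∧a≤⊥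

  -- Needed for joins indexed by complements: a pair with value `a` is found at an enumerated `b`
  -- equal to `- a`.
  -a≈b⇒a≈-b : ∀ {a b} → - a ≈ b → a ≈ - b
  -a≈b⇒a≈-b -a≈b = antisym
    (∧-disjoint⇒≤ (trans (∧-monotonic refl (reflexive (Eq.sym -a≈b))) a∧-a≤⊥)
      (trans (maximum _) ⊤≤a∨-a))
    (∧-disjoint⇒≤ -a∧a≤⊥
      (trans (maximum _) (trans ⊤≤-a∨a (∨-monotonic (reflexive -a≈b) refl))))

  -- The meet of a with those enumerated x that keep it non-zero decides every x.
  refine : ∀ xs {a} → a ≉ ⊥ →
           ∃[ e ] (e ≤ a × e ≉ ⊥ × All (λ x → e ≤ x ⊎ e ∧ x ≤ ⊥) xs)
  refine [] {a} a≉⊥ = a , refl , a≉⊥ , []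
  refine (x ∷ xs) {a} a≉⊥ with (a ∧ x) ≟ ⊥
  ... | yes a∧x≈⊥ =
    let e , e≤a , e≉⊥ , all = refine xs a≉⊥
    in e , e≤a , e≉⊥
     , inj₂ (trans (∧-greatest (trans (x∧y≤x _ _) e≤a) (x∧y≤y _ _)) (reflexive a∧x≈⊥))
       ∷ all
  ... | no a∧x≉⊥ =
    let e , e≤a∧x , e≉⊥ , all = refine xs a∧x≉⊥
    in e , trans e≤a∧x (x∧y≤x _ _) , e≉⊥ , inj₁ (trans e≤a∧x (x∧y≤y _ _)) ∷ all

  -- A non-zero `b ≤ e` cannot be disjoint from `e`, so an `e` that decides every enumerated element
  -- lies below `b`.
  atom-below : ∀ {a} → a ≉ ⊥ → ∃[ e ] (IsAtom e × e ≤ a)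
  atom-below a≉⊥ =
    let e , e≤a , e≉⊥ , all = refine elements a≉⊥
    in e , record { nonzero = e≉⊥ ; minimal = minimal all } , e≤a
    where
    minimal : ∀ {e b} → All (λ x → e ≤ x ⊎ e ∧ x ≤ ⊥) elements → b ≉ ⊥ → b ≤ e → b ≈ e
    minimal {b = b} all b≉⊥ b≤e with find (∈-elements b)
    ... | x , x∈ , b≈x with All.lookup all x∈
    ...   | inj₁ e≤x   = antisym b≤e (trans e≤x (reflexive (Eq.sym b≈x)))
    ...   | inj₂ e∧x≤⊥ = ⊥-elim (b≉⊥ (antisym
              (trans (∧-greatest b≤e (reflexive b≈x)) e∧x≤⊥) (minimum _)))

  -- Any atom below `a ∧ - b` will do; this meet is non-zero because `a ≰ b`.
  separating-atom-≰ : ∀ {a b} → a ≰ b → ∃[ e ] (IsAtom e × e ≤ a × e ≰ b)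
  separating-atom-≰ {a} {b} a≰b =
    let e , atom , e≤a∧-b = atom-below a∧-b≉⊥
    in e , atom , trans e≤a∧-b (x∧y≤x _ _)
     , λ e≤b → IsAtom.nonzero atom (antisym
         (trans (∧-greatest (trans e≤a∧-b (x∧y≤y _ _)) e≤b) -a∧a≤⊥) (minimum _))
    where
    a∧-b≉⊥ : (a ∧ - b) ≉ ⊥
    a∧-b≉⊥ a∧-b≈⊥ =
      a≰b (∧-disjoint⇒≤ (reflexive a∧-b≈⊥) (trans (maximum _) ⊤≤-a∨a))

  separating-atom : ∀ {a b} → a ≉ b →
                    ∃[ e ] (IsAtom e × ((e ≤ a × e ≰ b) ⊎ (e ≰ a × e ≤ b)))
  separating-atom {a} {b} a≉b with a ≤? b
  ... | no a≰b =
    let e , atom , e≤a , e≰b = separating-atom-≰ a≰b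
    in e , atom , inj₁ (e≤a , e≰b)
  ... | yes a≤b =
    let e , atom , e≤b , e≰a = separating-atom-≰ (a≉b ∘ antisym a≤b)
    in e , atom , inj₂ (e≰a , e≤b)

  module Atom {e} (atom : IsAtom e) where

    open IsAtom atom

    e≰⊥ : e ≰ ⊥
    e≰⊥ e≤⊥ = nonzero (antisym e≤⊥ (minimum _))

    ≰⇒disjoint : ∀ {a} → e ≰ a → e ∧ a ≤ ⊥
    ≰⇒disjoint {a} e≰a with (e ∧ a) ≟ ⊥
    ... | yes e∧a≈⊥ = reflexive e∧a≈⊥
    ... | no  e∧a≉⊥ = ⊥-elim (e≰a
            (trans (reflexive (Eq.sym (minimal e∧a≉⊥ (x∧y≤x _ _)))) (x∧y≤y _ _)))

    prime : ∀ {a b} → e ≤ a ∨ b → e ≤ a ⊎ e ≤ b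
    prime {a} e≤a∨b with e ≤? a
    ... | yes e≤a = inj₁ e≤a
    ... | no  e≰a = inj₂ (∧-disjoint⇒≤ (≰⇒disjoint e≰a) e≤a∨b)

    ≰⇒≤- : ∀ {a} → e ≰ a → e ≤ - a
    ≰⇒≤- e≰a = ∧-disjoint⇒≤ (≰⇒disjoint e≰a)
      (trans (maximum _) ⊤≤a∨-a)

    ≤-⇒≰ : ∀ {a} → e ≤ a → e ≰ - a
    ≤-⇒≰ e≤a e≤-a = e≰⊥ (trans (∧-greatest e≤a e≤-a) a∧-a≤⊥)

-- Inconsistency of finite sets of pairs at an atom.

module LatticeMapsProperties {c ℓ₁ ℓ₂ c′ ℓ₁′ ℓ₂′}
  (L : BoundedDistributiveLattice c ℓ₁ ℓ₂)
  (B : FiniteDiscreteBooleanAlgebra c′ ℓ₁′ ℓ₂′) where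

  private
    module L where
      open BoundedDistributiveLattice L public
      open BoundedDistributiveLatticeProperties L public
    module B where
      open FiniteDiscreteBooleanAlgebra B public
      open FiniteDiscreteBooleanAlgebraProperties B public

  open LatticeMaps L B
  open Entailment L×B
  open Membership L×B using (_∈_)
  open Subset L×B using (_⊆_)

  private
    Pairs : Set _
    Pairs = List (L.Carrier × B.Carrier)

    first : ∀ {z Z} → z ∈ z ∷ Z
    first = here (L.Eq.refl , B.Eq.refl)

    second : ∀ {w z Z} → z ∈ w ∷ z ∷ Z
    second = there first

  -- Equivalent to ⋀ P ≤ ⋁ Q, stated through bounds to avoid list manipulations.
  InconsistentAt : B.Carrier → Pairs → Set _
  InconsistentAt e Z = ∀ p q →
    (∀ {x a} → (x , a) ∈ Z → e B.≤ a → p L.≤ x) →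
    (∀ {x a} → (x , a) ∈ Z → e B.≰ a → x L.≤ q) →
    p L.≤ q

  Inconsistent : Pairs → Set _
  Inconsistent Z = ∃[ e ] (B.IsAtom e × InconsistentAt e Z)

  inconsistentAt-resp-≈ : ∀ {e e′ Z} → e B.≈ e′ → InconsistentAt e Z → InconsistentAt e′ Z
  inconsistentAt-resp-≈ e≈e′ inc p q lower upper = inc p q
    (λ z∈Z e≤a → lower z∈Z (B.trans (B.reflexive (B.Eq.sym e≈e′)) e≤a))
    (λ z∈Z e≰a → upper z∈Z (e≰a ∘ B.trans (B.reflexive e≈e′)))

  -- At an atom separating `a` from `b`, the element `x` is bounded on both sides, so `p ≤ x ≤ q`.
  conflict⇒inconsistent : ∀ {Z x a b} → (x , a) ∈ Z → (x , b) ∈ Z → a B.≉ b → Inconsistent Z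
  conflict⇒inconsistent xa∈Z xb∈Z a≉b with B.separating-atom a≉b
  ... | e , atom , inj₁ (e≤a , e≰b) =
    e , atom , λ p q lower upper → L.trans (lower xa∈Z e≤a) (upper xb∈Z e≰b)
  ... | e , atom , inj₂ (e≰a , e≤b) =
    e , atom , λ p q lower upper → L.trans (lower xb∈Z e≤b) (upper xa∈Z e≰a)

  -- At `e`, value `a` puts `u` among the joinands and value `b` among the meetands, so this is cut
  -- on `u` in `L`.
  inconsistentAt-cut : ∀ {e Z u a b} → e B.≰ a → e B.≤ b →
    InconsistentAt e ((u , a) ∷ Z) → InconsistentAt e ((u , b) ∷ Z) → InconsistentAt e Z
  inconsistentAt-cut {e} {Z} {u} {a} {b} e≰a e≤b incᵃ incᵇ p q lower upper =
    L.≤-cut (incᵃ p (q L.∨ u) lowerᵃ upperᵃ) (incᵇ (p L.∧ u) q lowerᵇ upperᵇ)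
    where
    lowerᵃ : ∀ {x d} → (x , d) ∈ (u , a) ∷ Z → e B.≤ d → p L.≤ x
    lowerᵃ (here (_ , d≈a)) e≤d = ⊥-elim (e≰a (B.trans e≤d (B.reflexive d≈a)))
    lowerᵃ (there z∈Z)      e≤d = lower z∈Z e≤d

    upperᵃ : ∀ {x d} → (x , d) ∈ (u , a) ∷ Z → e B.≰ d → x L.≤ q L.∨ u
    upperᵃ (here (x≈u , _)) e≰d = L.trans (L.reflexive x≈u) (L.y≤x∨y _ _)
    upperᵃ (there z∈Z)      e≰d = L.trans (upper z∈Z e≰d) (L.x≤x∨y _ _)

    lowerᵇ : ∀ {x d} → (x , d) ∈ (u , b) ∷ Z → e B.≤ d → p L.∧ u L.≤ x
    lowerᵇ (here (x≈u , _)) e≤d = L.trans (L.x∧y≤y _ _) (L.reflexive (L.Eq.sym x≈u))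
    lowerᵇ (there z∈Z)      e≤d = L.trans (L.x∧y≤x _ _) (lower z∈Z e≤d)

    upperᵇ : ∀ {x d} → (x , d) ∈ (u , b) ∷ Z → e B.≰ d → x L.≤ q
    upperᵇ (here (_ , d≈b)) e≰d =
      ⊥-elim (e≰d (B.trans e≤b (B.reflexive (B.Eq.sym d≈b))))
    upperᵇ (there z∈Z)      e≰d = upper z∈Z e≰d

  -- The difficulty is that each value `a` comes with its own atom, whereas cut needs two suitable
  -- values at the same atom.
  inconsistent-cut : ∀ {u Z} → (∀ a → Inconsistent ((u , a) ∷ Z)) → Inconsistent Z
  inconsistent-cut {u} {Z} inc =
    -- No atom lies below `⊥`, so nothing has to be refuted at the start.
    search B.⊥ B.elements (<-wellFounded _)
      (λ atom e≤⊥ → ⊥-elim (B.Atom.e≰⊥ atom e≤⊥)) (λ {e} _ _ → B.∈-elements e)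
    where
    open Membership B.setoid using () renaming (_∈_ to _∈ᴮ_)

    Refuted : B.Carrier → Set _
    Refuted e = ∃[ a ] (e B.≰ a × InconsistentAt e ((u , a) ∷ Z))

    -- Every atom joined to d is removed from es, so es shrinks at each query.
    search : ∀ d es → Acc _<_ (length es) →
             (∀ {e} → B.IsAtom e → e B.≤ d → Refuted e) →
             (∀ {e} → B.IsAtom e → e B.≰ d → e ∈ᴮ es) →
             Inconsistent Z
    search d es (acc rec) refuted remaining with inc d
    ... | e , atom , incᵈ with e B.≤? d
    ...   | yes e≤d =
      let a , e≰a , incᵃ = refuted atom e≤d
      in e , atom , inconsistentAt-cut e≰a e≤d incᵃ incᵈ
    ...   | no e≰d = search (d B.∨ e) (filter ≉e? es)
              (rec (filter-notAll ≉e? es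
                (Any.map (λ e≈x x≉e → x≉e (B.Eq.sym e≈x)) (remaining atom e≰d))))
              refuted′ remaining′
      where
      ≉e? : ∀ x → Dec (x B.≉ e)
      ≉e? x = ¬? (x B.≟ e)

      refuted′ : ∀ {e′} → B.IsAtom e′ → e′ B.≤ d B.∨ e → Refuted e′
      refuted′ atom′ e′≤d∨e with B.Atom.prime atom′ e′≤d∨e
      ... | inj₁ e′≤d = refuted atom′ e′≤d
      ... | inj₂ e′≤e =
        let e′≈e = B.IsAtom.minimal atom (B.IsAtom.nonzero atom′) e′≤e
        -- The value `d` just queried refutes the new atom, since `e ≰ d`.
        in d , e≰d ∘ B.trans (B.reflexive (B.Eq.sym e′≈e))
         , inconsistentAt-resp-≈ (B.Eq.sym e′≈e) incᵈ

      remaining′ : ∀ {e′} → B.IsAtom e′ → e′ B.≰ d B.∨ e → e′ ∈ᴮ filter ≉e? es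
      remaining′ atom′ e′≰d∨e = ∈.∈-filter⁺ B.setoid ≉e?
        (λ x≈y x≉e y≈e → x≉e (B.Eq.trans x≈y y≈e))
        (remaining atom′ (λ e′≤d → e′≰d∨e (B.trans e′≤d (B.x≤x∨y _ _))))
        (λ e′≈e → e′≰d∨e (B.trans (B.reflexive e′≈e) (B.y≤x∨y _ _)))

  -- The semantic entailment relation and soundness.

  Contradicts : Pairs → Pairs → Set _
  Contradicts Z Y = ∀ {y b} → (y , b) ∈ Y → ∃[ b′ ] (b′ B.≉ b × (y , b′) ∈ Z)

  infix 4 _⊩_
  -- Quantifying over all larger `Z` makes monotonicity a composition of inclusions and lets cut
  -- adjoin a pair to `Z`.
  _⊩_ : FinRel _
  X ⊩ Y = ∀ {Z} → X ⊆ Z → Contradicts Z Y → Inconsistent Z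

  ⊩-isEntailmentRelation : IsEntailmentRelation _⊩_
  ⊩-isEntailmentRelation = record
    { reflexive  = λ z∈X z∈Y X⊆Z contra →
        let b′ , b′≉b , yb′∈Z = contra z∈Y
        in conflict⇒inconsistent yb′∈Z (X⊆Z z∈X) b′≉b
    ; mono       = λ X⊆X′ Y⊆Y′ X⊩Y X′⊆Z contra → X⊩Y (X′⊆Z ∘ X⊆X′) (contra ∘ Y⊆Y′)
    ; transitive = λ X⊩xY xX⊩Y X⊆Z contra → inconsistent-cut (cut X⊩xY xX⊩Y X⊆Z contra)
    }
    where
    -- If `a ≈ b`, the new pair serves as the extra hypothesis `(u , b)`; otherwise it contradicts
    -- the extra conclusion `(u , b)`.
    cut : ∀ {X Y Z u b} → X ⊩ (u , b) ∷ Y → (u , b) ∷ X ⊩ Y → X ⊆ Z → Contradicts Z Y →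
          ∀ a → Inconsistent ((u , a) ∷ Z)
    cut {X} {Y} {Z} {u} {b} X⊩xY xX⊩Y X⊆Z contra a with a B.≟ b
    ... | yes a≈b = xX⊩Y
      (λ { (here (x≈u , d≈b)) → here (x≈u , B.Eq.trans d≈b (B.Eq.sym a≈b))
         ; (there z∈X)        → there (X⊆Z z∈X) })
      (λ z∈Y → let b′ , b′≉b , z∈Z = contra z∈Y in b′ , b′≉b , there z∈Z)
    ... | no a≉b = X⊩xY (there ∘ X⊆Z)
      (λ { (here (x≈u , d≈b)) → a , (λ a≈d → a≉b (B.Eq.trans a≈d d≈b)) , here (x≈u , B.Eq.refl)
         ; (there z∈Y) → let b′ , b′≉b , z∈Z = contra z∈Y in b′ , b′≉b , there z∈Z })

  axiom-sound : ∀ {X Y} → Axiom X Y → X ⊩ Y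
  axiom-sound (ax-s a≉b) X⊆Z contra =
    conflict⇒inconsistent (X⊆Z first)
      (X⊆Z second) a≉b
  axiom-sound (ax-∧ {a = a}) {Z} X⊆Z contra
    with d , d≉a∧b , z∈Z ← contra first | B.separating-atom d≉a∧b
  ... | e , atom , inj₁ (e≤d , e≰a∧b) = e , atom , inc
    where
    inc : InconsistentAt e Z
    inc p q lower upper with e B.≤? a
    ... | no e≰a = L.trans (lower z∈Z e≤d) (L.trans (L.x∧y≤x _ _)
                     (upper (X⊆Z first) e≰a))
    ... | yes e≤a = L.trans (lower z∈Z e≤d) (L.trans (L.x∧y≤y _ _)
                     (upper (X⊆Z second)
                       (e≰a∧b ∘ B.∧-greatest e≤a)))
  ... | e , atom , inj₂ (e≰d , e≤a∧b) = e , atom , λ p q lower upper →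
    L.trans
      (L.∧-greatest
        (lower (X⊆Z first) (B.trans e≤a∧b (B.x∧y≤x _ _)))
        (lower (X⊆Z second) (B.trans e≤a∧b (B.x∧y≤y _ _))))
      (upper z∈Z e≰d)
  axiom-sound ax-∨ {Z} X⊆Z contra
    with d , d≉a∨b , z∈Z ← contra first | B.separating-atom d≉a∨b
  ... | e , atom , inj₁ (e≤d , e≰a∨b) = e , atom , λ p q lower upper →
    L.trans (lower z∈Z e≤d)
      (L.∨-least
        (upper (X⊆Z first)
          (λ e≤a → e≰a∨b (B.trans e≤a (B.x≤x∨y _ _))))
        (upper (X⊆Z second)
          (λ e≤b → e≰a∨b (B.trans e≤b (B.y≤x∨y _ _)))))
  ... | e , atom , inj₂ (e≰d , e≤a∨b) = e , atom , inc
    where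
    inc : InconsistentAt e Z
    inc p q lower upper with B.Atom.prime atom e≤a∨b
    ... | inj₁ e≤a = L.trans (lower (X⊆Z first) e≤a)
                       (L.trans (L.x≤x∨y _ _) (upper z∈Z e≰d))
    ... | inj₂ e≤b = L.trans (lower (X⊆Z second) e≤b)
                       (L.trans (L.y≤x∨y _ _) (upper z∈Z e≰d))
  axiom-sound ax-0 X⊆Z contra
    with d , d≉⊥ , z∈Z ← contra first =
    let e , atom , e≤d = B.atom-below d≉⊥
    in e , atom , λ p q lower upper → L.trans (lower z∈Z e≤d) (L.minimum _)
  axiom-sound ax-1 X⊆Z contra
    with d , d≉⊤ , z∈Z ← contra first =
    let e , atom , _ , e≰d = B.separating-atom-≰ (d≉⊤ ∘ B.antisym (B.maximum _))
    in e , atom , λ p q lower upper → L.trans (L.maximum _) (upper z∈Z e≰d)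
  axiom-sound (ax-t {x}) {Z} X⊆Z contra =
    -- Every value of `x` is contradicted, so `Z` gives `x` some value `a`, and then another value
    -- different from `a`. The starting value `⊥` is arbitrary.
    let a , _   , xa∈Z = wrong B.⊥
        b , b≉a , xb∈Z = wrong a
    in conflict⇒inconsistent xb∈Z xa∈Z b≉a
    where
    wrong : ∀ a → ∃[ b ] (b B.≉ a × (x , b) ∈ Z)
    wrong a = contra (∈.∈-map⁺ B.setoid L×B (L.Eq.refl ,_) (B.∈-elements a))

  sound : ∀ {X Y} → X ⊢ Y → X ⊩ Y
  sound X⊢Y = generated-least ⊩-isEntailmentRelation axiom-sound X⊢Y

  -- Inconsistency in terms of meets and joins of fibres.

  ∈-fibre : ∀ {Z x a b} → (x , a) ∈ Z → a B.≈ b → Any (x L.≈_) (fibre Z b)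
  ∈-fibre xa∈Z a≈b = ∈.∈-map⁺ L×B L.setoid proj₁
    (∈.∈-filter⁺ L×B _ (λ p≈q p≈b → B.Eq.trans (B.Eq.sym (proj₂ p≈q)) p≈b) xa∈Z a≈b)

  -- The enumeration contains `a` only up to `≈`, so the bound is required at every `b ≈ a`.
  ⋀[a≥]-lower : ∀ {e a x f} → e B.≤ a → (∀ {b} → a B.≈ b → f b L.≤ x) → ⋀[a≥ e ] f L.≤ x
  ⋀[a≥]-lower {e} {a} {f = f} e≤a f≤x =
    let b , b∈ , a≈b = find (B.∈-elements a)
    in L.⋀-lower (lose
         (∈ₚ-map⁺ f (∈ₚ-filter⁺ (e B.≤?_) b∈ (B.trans e≤a (B.reflexive a≈b)))) (f≤x a≈b))

  ⋁[a≥]-upper : ∀ {e a x f} → e B.≤ a → (∀ {b} → a B.≈ b → x L.≤ f b) → x L.≤ ⋁[a≥ e ] f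
  ⋁[a≥]-upper {e} {a} {f = f} e≤a x≤f =
    let b , b∈ , a≈b = find (B.∈-elements a)
    in L.⋁-upper (lose
         (∈ₚ-map⁺ f (∈ₚ-filter⁺ (e B.≤?_) b∈ (B.trans e≤a (B.reflexive a≈b)))) (x≤f a≈b))

  MeetsBelowJoins : B.Carrier → Pairs → Set _
  MeetsBelowJoins e Z =
    ⋀[a≥ e ] (λ a → L.⋀ (fibre Z a)) L.≤ ⋁[a≥ e ] (λ a → L.⋁ (fibre Z (B.- a)))

  -- For an atom, `e ≰ a` gives `e ≤ - a`, so the join over complements bounds every `x` paired with
  -- such an `a`.
  inconsistentAt⇒meetsBelowJoins : ∀ {e Z} → B.IsAtom e →
    InconsistentAt e Z → MeetsBelowJoins e Z
  inconsistentAt⇒meetsBelowJoins atom inc = inc _ _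
    (λ z∈Z e≤a → ⋀[a≥]-lower e≤a (λ a≈b →
      L.⋀-lower (Any.map (L.reflexive ∘ L.Eq.sym) (∈-fibre z∈Z a≈b))))
    (λ z∈Z e≰a → ⋁[a≥]-upper (B.Atom.≰⇒≤- atom e≰a) (λ -a≈b →
      L.⋁-upper (Any.map L.reflexive
        (∈-fibre z∈Z (B.-a≈b⇒a≈-b -a≈b)))))

  -- Derived rules and completeness.

  ⊢-cut-list : ∀ {X Y} zs → X ⊢ zs ++ Y → All (λ z → z ∷ X ⊢ Y) zs → X ⊢ Y
  ⊢-cut-list []       X⊢Y  []           = X⊢Y
  ⊢-cut-list (z ∷ zs) X⊢zs (zX⊢Y ∷ all) =
    ⊢-cut-list zs (trans X⊢zs (mono id (⊆.xs⊆ys++xs L×B _ zs) zX⊢Y)) all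

  -- Two successive cuts turn an axiom with two hypotheses into an inference rule.
  ⊢-binary : ∀ {X w z v} → X ⊢ [ w ] → X ⊢ [ z ] → w ∷ z ∷ [] ⊢ v → X ⊢ v
  ⊢-binary {X} {w} {z} X⊢w X⊢z wz⊢v =
    trans (mono id (λ { (here eq) → here eq }) X⊢w)
      (trans (mono there (λ { (here eq) → here eq }) X⊢z)
        (mono (λ { (here eq)         → there (here eq)
                 ; (there (here eq)) → here eq }) id wz⊢v))

  ⊢-resp-≈ : ∀ {X x y a} → x L.≈ y → X ⊢ [ (x , a) ] → X ⊢ [ (y , a) ]
  ⊢-resp-≈ x≈y = mono id
    (λ { (here (z≈x , d≈a)) → here (L.Eq.trans z≈x x≈y , d≈a) })

  module Derivations {e} (atom : B.IsAtom e) (X : Pairs) where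

    -- The values above the atom `e` form a prime filter, and the others its complementary ideal.
    -- Hence `Above` is closed under finite meets and `Beside` under finite joins.
    Above Beside : L.Carrier → Set _
    Above  x = ∃[ a ] (e B.≤ a × X ⊢ [ (x , a) ])
    Beside x = ∃[ a ] (e B.≰ a × X ⊢ [ (x , a) ])

    above-⋀ : ∀ {xs} → All Above xs → Above (L.⋀ xs)
    above-⋀ [] = B.⊤ , B.maximum _ , mono (λ ()) id (axiom ax-1)
    above-⋀ ((a , e≤a , d) ∷ all) =
      let b , e≤b , d′ = above-⋀ all
      in a B.∧ b , B.∧-greatest e≤a e≤b , ⊢-binary d d′ (axiom ax-∧)

    beside-⋁ : ∀ {xs} → All Beside xs → Beside (L.⋁ xs)
    beside-⋁ [] = B.⊥ , B.Atom.e≰⊥ atom , mono (λ ()) id (axiom ax-0)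
    beside-⋁ ((a , e≰a , d) ∷ all) =
      let b , e≰b , d′ = beside-⋁ all
      in a B.∨ b , Sum.[ e≰a , e≰b ] ∘ B.Atom.prime atom , ⊢-binary d d′ (axiom ax-∨)

    derive : ∀ {z} → z ∈ₚ X → X ⊢ [ z ]
    derive z∈X = refl (Any.map (λ { ≡.refl → L.Eq.refl , B.Eq.refl }) z∈X)
                      first

    fibre-all : ∀ {a ℓ} {P : L.Carrier → Set ℓ} →
                (∀ {x b} → b B.≈ a → X ⊢ [ (x , b) ] → P x) → All P (fibre X a)
    fibre-all {a} h = All.map⁺ (All.tabulate (λ z∈ →
      let z∈X , b≈a = ∈ₚ-filter⁻ (λ p → proj₂ p B.≟ a) z∈ in h b≈a (derive z∈X)))

    ≥-all : ∀ {ℓ} {P : L.Carrier → Set ℓ} {f} →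
            (∀ {a} → e B.≤ a → P (f a)) → All P (map f (filter (e B.≤?_) B.elements))
    ≥-all h = All.map⁺ (All.map h (All.all-filter (e B.≤?_) B.elements))

    meetsBelowJoins⇒⊢ : MeetsBelowJoins e X → X ⊢ []
    meetsBelowJoins⇒⊢ P≤Q =
      let p , e≤p , ⊢P = above-⋀ (≥-all (λ e≤a → above-⋀ (fibre-all (λ b≈a d →
                           _ , B.trans e≤a (B.reflexive (B.Eq.sym b≈a)) , d))))
          q , e≰q , ⊢Q = beside-⋁ (≥-all (λ e≤a → beside-⋁ (fibre-all (λ b≈-a d →
                           _ , (λ e≤b → B.Atom.≤-⇒≰ atom e≤a (B.trans e≤b (B.reflexive b≈-a))) , d))))
          -- This identification gives one element the two derivable values `p` and `p ∧ q`, which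
          -- differ because only `p` is above `e`.
          P∧Q≈P = L.antisym (L.x∧y≤x _ _) (L.∧-greatest L.refl P≤Q)
      in ⊢-binary ⊢P (⊢-resp-≈ P∧Q≈P (⊢-binary ⊢P ⊢Q (axiom ax-∧)))
           (axiom (ax-s (λ p≈p∧q →
             e≰q (B.trans e≤p (B.trans (B.reflexive p≈p∧q) (B.x∧y≤y _ _))))))

  -- Induction on `k`, cutting with totality at the first element: its correct value closes the
  -- branch by reflexivity, and a wrong value joins the hypotheses.
  ⊢-from-contradictions : ∀ {X} k (y : Fin k → L.Carrier) (b : Fin k → B.Carrier) →
    (∀ (b′ : Fin k → B.Carrier) → (∀ i → b′ i B.≉ b i) →
      X ++ tabulate (λ i → y i , b′ i) ⊢ []) →
    X ⊢ tabulate (λ i → y i , b i)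
  ⊢-from-contradictions {X} zero y b h =
    mono (λ p → Sum.[ id , (λ ()) ]′ (Any.++⁻ X p)) id (h (λ ()) (λ ()))
  ⊢-from-contradictions {X} (suc k) y b h =
    ⊢-cut-list (map (y zero ,_) B.elements)
      (mono (λ ()) (⊆.xs⊆xs++ys L×B _ _) (axiom ax-t))
      (All.map⁺ (All.universal branch B.elements))
    where
    branch : ∀ a → (y zero , a) ∷ X ⊢ tabulate (λ i → y i , b i)
    branch a with a B.≟ b zero
    ... | yes a≈b = refl first (here (L.Eq.refl , a≈b))
    ... | no  a≉b = mono id there
      (⊢-from-contradictions k (y ∘ suc) (b ∘ suc) (λ b′ b′≉b →
        -- The hypothesis `h` lists the wrong pair after `X`, the recursive call before it.
        mono (⊆.⊆-reflexive-↭ L×B (Permutation.shift L×B (L.Eq.refl , B.Eq.refl) X _)) id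
          (h (a Vector.∷ b′) (λ { zero → a≉b ; (suc i) → b′≉b i }))))

corollary3p11 : ∀ {c ℓ₁ ℓ₂ c′ ℓ₁′ ℓ₂′}
  (L : BoundedDistributiveLattice c ℓ₁ ℓ₂)
  (B : FiniteDiscreteBooleanAlgebra c′ ℓ₁′ ℓ₂′) →
  let module L = BoundedDistributiveLattice L
      module B = FiniteDiscreteBooleanAlgebra B
      open LatticeMaps L B
  in
  (X : List (L.Carrier × B.Carrier))
  (k : ℕ) (y : Fin k → L.Carrier) (b : Fin k → B.Carrier) →
  (X ⊢ tabulate (λ i → y i , b i))
  ⇔
  ((b′ : Fin k → B.Carrier) → (∀ i → b′ i B.≉ b i) →
    let X′ = X ++ tabulate (λ i → y i , b′ i) in
    ∃[ e ] (B.IsAtom e ×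
      (⋀[a≥ e ] (λ a → L.⋀ (fibre X′ a))
        L.≤ ⋁[a≥ e ] (λ a → L.⋁ (fibre X′ (B.- a))))))
corollary3p11 L B X k y b = mk⇔
  (λ X⊢Y b′ b′≉b →
    let e , atom , inc = sound X⊢Y (⊆.xs⊆xs++ys L×B X _) (contradicts b′ b′≉b)
    in e , atom , inconsistentAt⇒meetsBelowJoins atom inc)
  (λ h → ⊢-from-contradictions k y b (λ b′ b′≉b →
    let e , atom , P≤Q = h b′ b′≉b
    in Derivations.meetsBelowJoins⇒⊢ atom _ P≤Q))
  where
  module L = BoundedDistributiveLattice L
  module B = FiniteDiscreteBooleanAlgebra B
  open LatticeMaps L B
  open LatticeMapsProperties L B

  contradicts : ∀ b′ → (∀ i → b′ i B.≉ b i) →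
    Contradicts (X ++ tabulate (λ i → y i , b′ i)) (tabulate (λ i → y i , b i))
  contradicts b′ b′≉b z∈Y =
    let i , x≈yi , d≈bi = Any.tabulate⁻ z∈Y
    in b′ i , (λ b′i≈d → b′≉b i (B.Eq.trans b′i≈d d≈bi))
     , Any.++⁺ʳ X (Any.tabulate⁺ i (x≈yi , B.Eq.refl))
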